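{- For all positive integers $m,h,p$, $$hm^{p}S_{p}(h,m)+mh^{p}S_{p}(m,h)=\sum_{\mu=0}^{m-1}\sum_{\nu=0}^{h-1}(mh)^{p-1}(\mu h+m\nu)\,\overline{B}_{p}\Big(\frac{\nu}{h}+\frac{\mu}{m}\Big)=(mh)^{p}\sum_{\mu=0}^{m-1}\sum_{\nu=0}^{h-1}(mh)^{ -1}(\mu h+m\nu)\,\overline{B}_{p}\Big(\frac{\nu}{h}+\frac{\mu}{m}\Big).$$
   Context: The Bernoulli polynomials $B_n(x)$ are defined by $\frac{t}{e^{t}-1}e^{xt}=\sum_{n=0}^{\infty}B_{n}(x)\frac{t^{n}}{n!}$. For real $x$, $\langle x\rangle=x-[x]$ is the fractional part, where $[x]$ is the greatest integer not exceeding $x$, and $\overline{B}_n(x)=B_n(\langle x\rangle)$. For positive integers $h,m,p$, the generalized Dedekind sum (Apostol) is $S_{p}(h,m)=\sum_{\mu=1}^{m-1}\frac{\mu}{m}\,\overline{B}_{p}\big(\frac{h\mu}{m}\big)$. -}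

module Defs where

open import Algebra.Bundles using (CommutativeRing)
open import Data.Fin.Base using (toℕ)
import Data.Integer.Base as ℤ
open import Data.Nat.Base as ℕ using (ℕ; zero; suc; NonZero; _!; _∸_)
open import Data.Nat.Properties using (_!≢0)
open import Data.Rational.Base as ℚ
  using (ℚ; 0ℚ; 1ℚ; _+_; _*_; _-_; -_; _÷_; 1/_; _/_; floor)
open import Data.Rational.Properties
open import Relation.Binary.PropositionalEquality

open import Algebra.Properties.Semiring.Sum
  (CommutativeRing.semiring +-*-commutativeRing) public
  using (sum; sum-syntax; sum⁺-syntax)
open import Algebra.Properties.Semiring.Exp
  (CommutativeRing.semiring +-*-commutativeRing) public
  using (_^_)

fromℕ : ℕ → ℚ
fromℕ n = ℤ.+ n / 1

infixl 7 _/ℕ_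

_/ℕ_ : (a n : ℕ) .{{_ : NonZero n}} → ℚ
a /ℕ n = ℤ.+ a / n

-- Formal power series over ℚ: the series f stands for ∑ₙ f n · tⁿ

Series : Set
Series = ℕ → ℚ

infixl 6 _⊝_
infixl 7 _⊛_ _⊘_ _⊘₁_

tail : Series → Series
tail f n = f (suc n)

one : Series
one zero    = 1ℚ
one (suc n) = 0ℚ

𝑡 : Series
𝑡 zero    = 0ℚ
𝑡 (suc n) = one n

_⊝_ : Series → Series → Series
(f ⊝ g) n = f n - g n

_⊛_ : Series → Series → Series
(f ⊛ g) n = ∑[ k ≤ n ] (f (toℕ k) * g (n ∸ toℕ k))

-- Long division by a series with nonzero constant term; see ⊘-⊛.
_⊘_ : Series → (f : Series) .{{_ : ℚ.NonZero (f 0)}} → Series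
(r ⊘ f) zero    = r 0 ÷ f 0
(r ⊘ f) (suc n) = (tail (λ k → r k - (r 0 ÷ f 0) * f k) ⊘ f) n

-- Division when numerator and denominator both have zero constant term:
-- a factor 𝑡 is cancelled first; see ⊘₁-⊛.
_⊘₁_ : Series → (f : Series) .{{_ : ℚ.NonZero (f 1)}} → Series
r ⊘₁ f = tail r ⊘ tail f

private
  ÷-* : ∀ p q .{{_ : ℚ.NonZero q}} → (p ÷ q) * q ≡ p
  ÷-* p q = trans (*-assoc p (1/ q) q)
           (trans (cong (p *_) (*-inverseˡ q)) (*-identityʳ p))

  +-minus : ∀ p q → p + (q - p) ≡ q
  +-minus p q = trans (+-comm p (q - p))
               (trans (+-assoc q (- p) p)
               (trans (cong (q +_) (+-inverseˡ p)) (+-identityʳ q)))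

  -- In (g ⊛ f) (suc n) the last term contains f 0.
  ⊛-tailʳ : ∀ g f → f 0 ≡ 0ℚ → ∀ n → (g ⊛ f) (suc n) ≡ (g ⊛ tail f) n
  ⊛-tailʳ g f f₀ zero    =
    cong (g 0 * f 1 +_)
      (trans (cong (λ z → g 1 * z + 0ℚ) f₀) (cong (_+ 0ℚ) (*-zeroʳ (g 1))))
  ⊛-tailʳ g f f₀ (suc n) = cong (g 0 * f (2 ℕ.+ n) +_) (⊛-tailʳ (tail g) f f₀ n)

⊘-⊛ : ∀ r f .{{_ : ℚ.NonZero (f 0)}} → ∀ n → (r ⊘ f ⊛ f) n ≡ r n
⊘-⊛ r f zero    = trans (+-identityʳ _) (÷-* (r 0) (f 0))
⊘-⊛ r f (suc n) = trans
  (cong ((r 0 ÷ f 0) * f (suc n) +_)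
    (⊘-⊛ (tail (λ k → r k - (r 0 ÷ f 0) * f k)) f n))
  (+-minus ((r 0 ÷ f 0) * f (suc n)) (r (suc n)))

⊘₁-⊛ : ∀ r f .{{_ : ℚ.NonZero (f 1)}} → r 0 ≡ 0ℚ → f 0 ≡ 0ℚ →
       ∀ n → (r ⊘₁ f ⊛ f) n ≡ r n
⊘₁-⊛ r f r₀ f₀ zero    = trans (+-identityʳ _)
  (trans (cong ((r ⊘₁ f) 0 *_) f₀) (trans (*-zeroʳ ((r ⊘₁ f) 0)) (sym r₀)))
⊘₁-⊛ r f r₀ f₀ (suc n) =
  trans (⊛-tailʳ (r ⊘₁ f) f f₀ n) (⊘-⊛ (tail r) (tail f) n)

-- exp x is the series of e^{xt}.
exp : ℚ → Series
exp x n = x ^ n * (1 /ℕ (n !)) {{n !≢0}}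

-- t / (eᵗ − 1) · e^{xt}
bernoulliSeries : ℚ → Series
bernoulliSeries x = 𝑡 ⊘₁ (exp 1ℚ ⊝ one) ⊛ exp x

-- bernoulliSeries x = ∑ₙ B n x · tⁿ / n!
B : ℕ → ℚ → ℚ
B n x = fromℕ (n !) * bernoulliSeries x n

-- Not the library's fracPart, which is ∣ x - truncate x ∣ and so differs
-- from x - floor x at negative x.
⟨_⟩ : ℚ → ℚ
⟨ x ⟩ = x - floor x / 1

B̄ : ℕ → ℚ → ℚ
B̄ n x = B n ⟨ x ⟩

-- S p h m = ∑_{μ=1}^{m-1} (μ / m) · B̄ p (h μ / m), with μ = suc (toℕ i).
S : (p h m : ℕ) .{{_ : NonZero m}} → ℚ
S p h m = ∑[ i < m ∸ 1 ]
  (suc (toℕ i) /ℕ m * B̄ p ((h ℕ.* suc (toℕ i)) /ℕ m))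

{-# OPTIONS --safe #-}

-- Write d = eᵗ − 1 and β = t / d. The series ∑_{ν<h} β(ht) e^{(hx+ν)t}
-- telescopes to h t e^{hxt} when multiplied by d, and d can be cancelled: this
-- is the multiplication formula hⁿ ∑_{ν<h} Bₙ(x + ν/h) = h Bₙ(hx).
-- Both sides of its analogue for B̄ are invariant under x ↦ x + 1/h, so it
-- reduces to the case 0 ≤ x < 1/h, where no fractional part intervenes.
-- Splitting μh + mν in the double sum and applying the formula to the sum over
-- ν in the first half and over μ in the second gives the two Dedekind sums.
module Submission where

open import Defs
open import Algebra.Bundles using (CommutativeRing)
open import Data.Fin.Base using (Fin; toℕ; zero; suc)
open import Data.Fin.Properties using (toℕ<n; toℕ≤pred[n])
import Data.Integer.Base as ℤ
import Data.Integer.DivMod as ℤ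
import Data.Integer.Properties as ℤ
open import Data.Nat.Base as ℕ using (ℕ; zero; suc; NonZero; _∸_; _!)
open import Data.Nat.Combinatorics using (_C_; nCk≡n!/k![n-k]!; k![n∸k]!∣n!)
import Data.Nat.Coprimality as Coprimality
open import Data.Nat.DivMod using (m/n*n≡m)
open import Data.Nat.Properties as ℕ using (m*n≢0; _!≢0; _!*_!≢0)
open import Data.Product.Base using (_×_; _,_)
open import Data.Rational.Base as ℚ
  using (ℚ; 0ℚ; 1ℚ; _+_; _*_; _-_; -_; _/_; _≤_; _<_; floor; *≤*; *<*; mkℚ;
         toℚᵘ; ↥_; ↧_; ↧ₙ_; Positive; NonNegative)
open import Data.Rational.Properties
open import Data.Rational.Solver using (module +-*-Solver)
import Data.Rational.Unnormalised.Base as ℚᵘ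
import Data.Rational.Unnormalised.Properties as ℚᵘ
open import Relation.Binary.PropositionalEquality

open import Algebra.Properties.Semiring.Sum
  (CommutativeRing.semiring +-*-commutativeRing)
  using (*-distribˡ-sum; *-distribʳ-sum; ∑-distrib-+; ∑-comm; sum-cong-≗)
open import Algebra.Properties.CommutativeSemiring.Exp
  (CommutativeRing.commutativeSemiring +-*-commutativeRing)
  using (^-distrib-*)
open import Algebra.Properties.Monoid.Mult +-0-monoid
  using () renaming (_×_ to _·ℕ_)
import Algebra.Properties.CommutativeSemiring.Binomial
  (CommutativeRing.commutativeSemiring +-*-commutativeRing) as Binomial
open +-*-Solver using (solve; _:+_; _:*_; _:-_; :-_; _:=_; con)

-- Arithmetic of fractions and of the embedding of ℕ in ℚ.

toℚᵘ-/ : ∀ i n .{{_ : NonZero n}} → toℚᵘ (i / n) ℚᵘ.≃ i ℚᵘ./ n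
toℚᵘ-/ i (suc n) = toℚᵘ-fromℚᵘ (ℚᵘ.mkℚᵘ i n)

-- Fractions in ℚ are reduced to lowest terms, so the comparison is carried out on unnormalised
-- fractions, where a product is formed componentwise.
/-*-/ : ∀ i j m n .{{_ : NonZero m}} .{{_ : NonZero n}} →
        (i / m) * (j / n) ≡ (i ℤ.* j ℚ./ (m ℕ.* n)) {{m*n≢0 m n}}
/-*-/ i j m@(suc _) n@(suc _) = toℚᵘ-injective (begin
  toℚᵘ ((i / m) * (j / n))           ≈⟨ toℚᵘ-homo-* (i / m) (j / n) ⟩
  toℚᵘ (i / m) ℚᵘ.* toℚᵘ (j / n)     ≈⟨ ℚᵘ.*-cong (toℚᵘ-/ i m) (toℚᵘ-/ j n) ⟩
  (i ℚᵘ./ m) ℚᵘ.* (j ℚᵘ./ n)         ≡⟨⟩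
  (i ℤ.* j) ℚᵘ./ (m ℕ.* n)           ≈⟨ toℚᵘ-/ (i ℤ.* j) (m ℕ.* n) ⟨
  toℚᵘ (i ℤ.* j / (m ℕ.* n))         ∎)
  where open ℚᵘ.≃-Reasoning

fromℤ-+ : ∀ i j → (i ℤ.+ j) / 1 ≡ i / 1 + j / 1
fromℤ-+ i j = toℚᵘ-injective (begin
  toℚᵘ ((i ℤ.+ j) / 1)                   ≈⟨ toℚᵘ-/ (i ℤ.+ j) 1 ⟩
  (i ℤ.+ j) ℚᵘ./ 1
    -- Unnormalised addition cross-multiplies, so the numerators first have to appear as `i * 1` and
    -- `j * 1`.
    ≡⟨ cong₂ (λ a b → (a ℤ.+ b) ℚᵘ./ 1) (sym (ℤ.*-identityʳ i)) (sym (ℤ.*-identityʳ j)) ⟩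
  (i ℚᵘ./ 1) ℚᵘ.+ (j ℚᵘ./ 1)             ≈⟨ ℚᵘ.+-cong (toℚᵘ-/ i 1) (toℚᵘ-/ j 1) ⟨
  toℚᵘ (i / 1) ℚᵘ.+ toℚᵘ (j / 1)         ≈⟨ toℚᵘ-homo-+ (i / 1) (j / 1) ⟨
  toℚᵘ (i / 1 + j / 1)                   ∎)
  where open ℚᵘ.≃-Reasoning

fromℕ-+ : ∀ m n → fromℕ (m ℕ.+ n) ≡ fromℕ m + fromℕ n
fromℕ-+ m n = fromℤ-+ (ℤ.+ m) (ℤ.+ n)

fromℕ-* : ∀ m n → fromℕ (m ℕ.* n) ≡ fromℕ m * fromℕ n
fromℕ-* m n = sym (trans (/-*-/ (ℤ.+ m) (ℤ.+ n) 1 1) (cong (_/ 1) (sym (ℤ.pos-* m n))))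

-- Turns fractions with denominator `n` into multiples of the single number `1 /ℕ n`, so that
-- identities between them become ring identities.
/ℕ-def : ∀ a n .{{_ : NonZero n}} → a /ℕ n ≡ fromℕ a * (1 /ℕ n)
/ℕ-def a n = sym (trans (/-*-/ (ℤ.+ a) (ℤ.+ 1) 1 n)
  (/-cong {{m*n≢0 1 n}} (ℤ.*-identityʳ (ℤ.+ a)) (ℕ.*-identityˡ n)))

fromℕ-inverse : ∀ n .{{_ : NonZero n}} → fromℕ n * (1 /ℕ n) ≡ 1ℚ
fromℕ-inverse n@(suc _) = trans (sym (/ℕ-def n n))
  (toℚᵘ-injective (ℚᵘ.≃-trans (toℚᵘ-/ (ℤ.+ n) n) (ℚᵘ.*≡* (ℤ.*-comm (ℤ.+ n) (ℤ.+ 1)))))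

-- Formal power series: the ring laws of `⊛`.

infixr 8 _·_

_·_ : ℚ → Series → Series
(c · f) n = c * f n

⊛-cong : ∀ {f f′ g g′} → f ≗ f′ → g ≗ g′ → f ⊛ g ≗ f′ ⊛ g′
⊛-cong f≗f′ g≗g′ n =
  sum-cong-≗ {suc n} (λ k → cong₂ _*_ (f≗f′ (toℕ k)) (g≗g′ (n ∸ toℕ k)))

⊛-distribʳ-∑ : ∀ {N} (f : Fin N → Series) g →
  (λ k → ∑[ i < N ] f i k) ⊛ g ≗ (λ n → ∑[ i < N ] (f i ⊛ g) n)
⊛-distribʳ-∑ {N} f g n = trans
  (sum-cong-≗ {suc n} (λ k → *-distribʳ-sum {N} (g (n ∸ toℕ k)) (λ i → f i (toℕ k))))
  (∑-comm {suc n} {N} (λ k i → f i (toℕ k) * g (n ∸ toℕ k)))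

-- The sum in `⊛` unfolds at its first term. Splitting off the last term instead is what the
-- induction in `⊛-comm` needs.
⊛-suc : ∀ f g n → (f ⊛ g) (suc n) ≡ (f ⊛ tail g) n + f (suc n) * g 0
⊛-suc f g zero    = solve 2 (λ a b → a :+ (b :+ con 0ℚ) := (a :+ con 0ℚ) :+ b) refl
  (f 0 * g 1) (f 1 * g 0)
⊛-suc f g (suc n) = trans (cong (f 0 * g (suc (suc n)) +_) (⊛-suc (tail f) g n))
  (sym (+-assoc (f 0 * g (suc (suc n))) ((tail f ⊛ tail g) n) (f (suc (suc n)) * g 0)))

⊛-comm : ∀ f g → f ⊛ g ≗ g ⊛ f
⊛-comm f g zero    = cong (_+ 0ℚ) (*-comm (f 0) (g 0))
⊛-comm f g (suc n) = begin
  f 0 * g (suc n) + (tail f ⊛ g) n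
    ≡⟨ cong₂ _+_ (*-comm (f 0) (g (suc n))) (⊛-comm (tail f) g n) ⟩
  g (suc n) * f 0 + (g ⊛ tail f) n  ≡⟨ +-comm (g (suc n) * f 0) _ ⟩
  (g ⊛ tail f) n + g (suc n) * f 0  ≡⟨ ⊛-suc g f n ⟨
  (g ⊛ f) (suc n)                   ∎
  where open ≡-Reasoning

·-⊛ : ∀ c f g → (c · f) ⊛ g ≗ c · (f ⊛ g)
·-⊛ c f g n = trans
  (sum-cong-≗ {suc n} (λ k → *-assoc c (f (toℕ k)) (g (n ∸ toℕ k))))
  (sym (*-distribˡ-sum {suc n} c (λ k → f (toℕ k) * g (n ∸ toℕ k))))

⊛-distribʳ-+ : ∀ f g h n → ((λ k → f k + g k) ⊛ h) n ≡ (f ⊛ h) n + (g ⊛ h) n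
⊛-distribʳ-+ f g h n = trans
  (sum-cong-≗ {suc n} (λ k → *-distribʳ-+ (h (n ∸ toℕ k)) (f (toℕ k)) (g (toℕ k))))
  (∑-distrib-+ {suc n} (λ k → f (toℕ k) * h (n ∸ toℕ k)) (λ k → g (toℕ k) * h (n ∸ toℕ k)))

⊛-assoc : ∀ f g h → (f ⊛ g) ⊛ h ≗ f ⊛ (g ⊛ h)
⊛-assoc f g h zero    = solve 3 (λ a b c →
  (a :* b :+ con 0ℚ) :* c :+ con 0ℚ := a :* (b :* c :+ con 0ℚ) :+ con 0ℚ) refl (f 0) (g 0) (h 0)
⊛-assoc f g h (suc n) = begin
  (f 0 * g 0 + 0ℚ) * h (suc n) + (tail (f ⊛ g) ⊛ h) n
    ≡⟨ cong ((f 0 * g 0 + 0ℚ) * h (suc n) +_) (begin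
      (tail (f ⊛ g) ⊛ h) n
        -- By definition `tail (f ⊛ g)` is the sum of `f 0 · tail g` and `tail f ⊛ g`.
        ≡⟨ ⊛-distribʳ-+ (f 0 · tail g) (tail f ⊛ g) h n ⟩
      (f 0 · tail g ⊛ h) n + ((tail f ⊛ g) ⊛ h) n
        ≡⟨ cong₂ _+_ (·-⊛ (f 0) (tail g) h n) (⊛-assoc (tail f) g h n) ⟩
      f 0 * (tail g ⊛ h) n + (tail f ⊛ (g ⊛ h)) n ∎) ⟩
  (f 0 * g 0 + 0ℚ) * h (suc n) + (f 0 * (tail g ⊛ h) n + (tail f ⊛ (g ⊛ h)) n)
    ≡⟨ solve 5 (λ a b c d e →
         (a :* b :+ con 0ℚ) :* c :+ (a :* d :+ e) := a :* (b :* c :+ d) :+ e)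
         refl (f 0) (g 0) (h (suc n)) ((tail g ⊛ h) n) ((tail f ⊛ (g ⊛ h)) n) ⟩
  f 0 * (g 0 * h (suc n) + (tail g ⊛ h) n) + (tail f ⊛ (g ⊛ h)) n ∎
  where open ≡-Reasoning

⊛-distribʳ-⊝ : ∀ f g h → (f ⊝ g) ⊛ h ≗ (f ⊛ h) ⊝ (g ⊛ h)
⊛-distribʳ-⊝ f g h n = begin
  ((f ⊝ g) ⊛ h) n
    ≡⟨ ⊛-cong {g = h} (λ k → cong (f k +_) (neg-mul (g k))) (λ _ → refl) n ⟩
  ((λ k → f k + ((- 1ℚ) · g) k) ⊛ h) n
    ≡⟨ ⊛-distribʳ-+ f ((- 1ℚ) · g) h n ⟩
  (f ⊛ h) n + ((- 1ℚ) · g ⊛ h) n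
    ≡⟨ cong ((f ⊛ h) n +_) (trans (·-⊛ (- 1ℚ) g h n) (sym (neg-mul ((g ⊛ h) n)))) ⟩
  (f ⊛ h) n - (g ⊛ h) n ∎
  where
  open ≡-Reasoning
  neg-mul : ∀ p → - p ≡ - 1ℚ * p
  neg-mul p = trans (cong -_ (sym (*-identityˡ p))) (neg-distribˡ-* 1ℚ p)

⊛-zeroˡ : ∀ g → (λ _ → 0ℚ) ⊛ g ≗ (λ _ → 0ℚ)
⊛-zeroˡ g zero    = trans (+-identityʳ _) (*-zeroˡ (g 0))
⊛-zeroˡ g (suc n) = trans (cong₂ _+_ (*-zeroˡ (g (suc n))) (⊛-zeroˡ g n)) (+-identityʳ 0ℚ)

one-⊛ : ∀ g → one ⊛ g ≗ g
one-⊛ g zero    = trans (+-identityʳ _) (*-identityˡ (g 0))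
one-⊛ g (suc n) = trans (cong₂ _+_ (*-identityˡ (g (suc n))) (⊛-zeroˡ g n)) (+-identityʳ _)

𝑡-⊛ : ∀ g n → (𝑡 ⊛ g) (suc n) ≡ g n
𝑡-⊛ g n = trans (cong₂ _+_ (*-zeroˡ (g (suc n))) (one-⊛ g n)) (+-identityˡ _)

-- The series f(ct), obtained by substituting ct for t.
scale : ℚ → Series → Series
scale c f n = c ^ n * f n

scale-⊛ : ∀ c f g → scale c f ⊛ scale c g ≗ scale c (f ⊛ g)
scale-⊛ c f g zero = solve 2 (λ a b →
  (con 1ℚ :* a) :* (con 1ℚ :* b) :+ con 0ℚ := con 1ℚ :* (a :* b :+ con 0ℚ)) refl (f 0) (g 0)
scale-⊛ c f g (suc n) = begin
  (1ℚ * f 0) * ((c * c ^ n) * g (suc n)) + (tail (scale c f) ⊛ scale c g) n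
    ≡⟨ cong ((1ℚ * f 0) * ((c * c ^ n) * g (suc n)) +_) (begin
      (tail (scale c f) ⊛ scale c g) n
        ≡⟨ ⊛-cong {g = scale c g} (λ k → *-assoc c (c ^ k) (f (suc k))) (λ _ → refl) n ⟩
      (c · scale c (tail f) ⊛ scale c g) n ≡⟨ ·-⊛ c (scale c (tail f)) (scale c g) n ⟩
      c * (scale c (tail f) ⊛ scale c g) n ≡⟨ cong (c *_) (scale-⊛ c (tail f) g n) ⟩
      c * (c ^ n * (tail f ⊛ g) n)         ∎) ⟩
  (1ℚ * f 0) * ((c * c ^ n) * g (suc n)) + c * (c ^ n * (tail f ⊛ g) n)
    ≡⟨ solve 5 (λ a b c d e →
         (con 1ℚ :* a) :* ((b :* c) :* d) :+ b :* (c :* e) := (b :* c) :* (a :* d :+ e))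
         refl (f 0) c (c ^ n) (g (suc n)) ((tail f ⊛ g) n) ⟩
  c * c ^ n * (f 0 * g (suc n) + (tail f ⊛ g) n) ∎
  where open ≡-Reasoning

-- Exponential series and their products.

scale-exp : ∀ c x → scale c (exp x) ≗ exp (c * x)
scale-exp c x n = trans (sym (*-assoc (c ^ n) (x ^ n) _))
  (cong (_* _) (sym (^-distrib-* c x n)))

-- In the binomial theorem used below, binomial coefficients act by repeated addition; this replaces
-- that action by multiplication in ℚ.
·ℕ-def : ∀ n x → n ·ℕ x ≡ fromℕ n * x
·ℕ-def zero    x = sym (*-zeroˡ x)
·ℕ-def (suc n) x = begin
  x + n ·ℕ x             ≡⟨ cong₂ _+_ (sym (*-identityˡ x)) (·ℕ-def n x) ⟩
  1ℚ * x + fromℕ n * x   ≡⟨ *-distribʳ-+ x 1ℚ (fromℕ n) ⟨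
  (1ℚ + fromℕ n) * x     ≡⟨ cong (_* x) (fromℕ-+ 1 n) ⟨
  fromℕ (suc n) * x      ∎
  where open ≡-Reasoning

1/!_ : ℕ → ℚ
1/! n = (1 /ℕ (n !)) {{n !≢0}}

-- The identity C(n,k) k! (n - k)! = n!, divided by all three factorials. It converts binomial
-- coefficients into the coefficients of a product of exponential series.
1/!-C : ∀ {n k} → k ℕ.≤ n → fromℕ (n C k) * 1/! n ≡ 1/! k * 1/! (n ∸ k)
1/!-C {n} {k} k≤n = begin
  c * r
    ≡⟨ solve 2 (λ c r → c :* r := c :* r :* con 1ℚ :* con 1ℚ) refl c r ⟩
  c * r * 1ℚ * 1ℚ
    ≡⟨ cong₂ (λ u v → c * r * u * v) (inv k) (inv l) ⟨
  c * r * (fromℕ (k !) * 1/! k) * (fromℕ (l !) * 1/! l)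
    ≡⟨ solve 6 (λ c r a a′ b b′ →
         c :* r :* (a :* a′) :* (b :* b′) := c :* (a :* b) :* r :* (a′ :* b′))
         refl c r (fromℕ (k !)) (1/! k) (fromℕ (l !)) (1/! l) ⟩
  c * (fromℕ (k !) * fromℕ (l !)) * r * (1/! k * 1/! l)
    ≡⟨ cong (λ u → u * r * (1/! k * 1/! l)) (trans (cong (c *_) (sym (fromℕ-* (k !) (l !))))
         (trans (sym (fromℕ-* (n C k) (k ! ℕ.* l !))) (cong fromℕ C*k!*l!≡n!))) ⟩
  fromℕ (n !) * r * (1/! k * 1/! l)
    ≡⟨ cong (_* (1/! k * 1/! l)) (inv n) ⟩
  1ℚ * (1/! k * 1/! l)
    ≡⟨ *-identityˡ _ ⟩
  1/! k * 1/! l ∎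
  where
  open ≡-Reasoning
  l = n ∸ k
  c = fromℕ (n C k)
  r = 1/! n
  inv : ∀ j → fromℕ (j !) * 1/! j ≡ 1ℚ
  inv j = fromℕ-inverse (j !) {{j !≢0}}
  C*k!*l!≡n! : (n C k) ℕ.* (k ! ℕ.* l !) ≡ n !
  C*k!*l!≡n! = trans (cong (ℕ._* (k ! ℕ.* l !)) (nCk≡n!/k![n-k]! k≤n))
    (m/n*n≡m {{k !* l !≢0}} (k![n∸k]!∣n! k≤n))

-- This is the binomial theorem for (x + y)ⁿ divided by n!, compared term by term.
exp-+ : ∀ x y → exp x ⊛ exp y ≗ exp (x + y)
exp-+ x y n = sym (begin
  (x + y) ^ n * 1/! n
    ≡⟨ cong (_* 1/! n) (Binomial.theorem n x y) ⟩
  Binomial.binomialExpansion x y n * 1/! n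
    ≡⟨ *-distribʳ-sum {suc n} (1/! n) (Binomial.binomialTerm x y n) ⟩
  ∑[ k ≤ n ] (Binomial.binomialTerm x y n k * 1/! n)
    ≡⟨ sum-cong-≗ {suc n} term ⟩
  (exp x ⊛ exp y) n ∎)
  where
  open ≡-Reasoning
  term : ∀ (i : Fin (suc n)) → Binomial.binomialTerm x y n i * 1/! n
    ≡ exp x (toℕ i) * exp y (n ∸ toℕ i)
  term i = begin
    ((n C k) ·ℕ (x ^ k * y ^ l)) * 1/! n
      ≡⟨ cong (_* 1/! n) (·ℕ-def (n C k) (x ^ k * y ^ l)) ⟩
    fromℕ (n C k) * (x ^ k * y ^ l) * 1/! n
      ≡⟨ solve 4 (λ c a b r → c :* (a :* b) :* r := (a :* b) :* (c :* r))
           refl (fromℕ (n C k)) (x ^ k) (y ^ l) (1/! n) ⟩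
    (x ^ k * y ^ l) * (fromℕ (n C k) * 1/! n)
      ≡⟨ cong (x ^ k * y ^ l *_) (1/!-C (toℕ≤pred[n] i)) ⟩
    (x ^ k * y ^ l) * (1/! k * 1/! l)
      ≡⟨ solve 4 (λ a b c d → (a :* b) :* (c :* d) := (a :* c) :* (b :* d))
           refl (x ^ k) (y ^ l) (1/! k) (1/! l) ⟩
    exp x k * exp y l ∎
    where
    k = toℕ i
    l = n ∸ k

-- The generating function of the Bernoulli polynomials.

∑-telescope : ∀ n (g : ℕ → ℚ) → ∑[ i < n ] (g (suc (toℕ i)) - g (toℕ i)) ≡ g n - g 0
∑-telescope zero    g = sym (+-inverseʳ (g 0))
∑-telescope (suc n) g = trans (cong (g 1 - g 0 +_) (∑-telescope n (λ i → g (suc i))))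
  (solve 3 (λ a b c → (b :- a) :+ (c :- b) := c :- a) refl (g 0) (g 1) (g (suc n)))

expm1 : Series
expm1 = exp 1ℚ ⊝ one

-- With this name, `bernoulliSeries x` is definitionally `β ⊛ exp x`.
β : Series
β = 𝑡 ⊘₁ expm1

β-expm1 : β ⊛ expm1 ≗ 𝑡
β-expm1 = ⊘₁-⊛ 𝑡 expm1 refl refl

-- Multiplication by β turns the factor eᵗ − 1 into 𝑡, which only shifts coefficients.
expm1-cancelʳ : ∀ {f g} → f ⊛ expm1 ≗ g ⊛ expm1 → f ≗ g
expm1-cancelʳ {f} {g} eq n = begin
  f n                               ≡⟨ recover f ⟩
  (β ⊛ (f ⊛ expm1)) (suc n)         ≡⟨ ⊛-cong {β} (λ _ → refl) eq (suc n) ⟩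
  (β ⊛ (g ⊛ expm1)) (suc n)         ≡⟨ recover g ⟨
  g n                               ∎
  where
  open ≡-Reasoning
  recover : ∀ f → f n ≡ (β ⊛ (f ⊛ expm1)) (suc n)
  recover f = begin
    f n                              ≡⟨ 𝑡-⊛ f n ⟨
    (𝑡 ⊛ f) (suc n)                  ≡⟨ ⊛-cong {g = f} β-expm1 (λ _ → refl) (suc n) ⟨
    ((β ⊛ expm1) ⊛ f) (suc n)        ≡⟨ ⊛-assoc β expm1 f (suc n) ⟩
    (β ⊛ (expm1 ⊛ f)) (suc n)        ≡⟨ ⊛-cong {β} (λ _ → refl) (⊛-comm expm1 f) (suc n) ⟩
    (β ⊛ (f ⊛ expm1)) (suc n)        ∎

-- Needed for two values of `y`: with y = 1 it gives one step of the telescoping sum, with y = N the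
-- difference between its two ends.
exp-diff : ∀ x y → (exp y ⊝ one) ⊛ exp x ≗ exp (x + y) ⊝ exp x
exp-diff x y n = trans (⊛-distribʳ-⊝ (exp y) one (exp x) n)
  (cong₂ _-_ (trans (exp-+ y x n) (cong (λ z → exp z n) (+-comm y x))) (one-⊛ (exp x) n))

⊛-distribˡ-⊝ : ∀ f g h → f ⊛ (g ⊝ h) ≗ (f ⊛ g) ⊝ (f ⊛ h)
⊛-distribˡ-⊝ f g h n = trans (⊛-comm f (g ⊝ h) n)
  (trans (⊛-distribʳ-⊝ g h f n) (cong₂ _-_ (⊛-comm g f n) (⊛-comm h f n)))

-- The factor eᵗ - 1 turns each term f e^{xt} into the difference of two consecutive ones, which
-- makes the sum over x, x + 1, x + 2, ... telescope.
⊛-exp-⊛-expm1 : ∀ f x → (f ⊛ exp x) ⊛ expm1 ≗ (f ⊛ exp (x + 1ℚ)) ⊝ (f ⊛ exp x)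
⊛-exp-⊛-expm1 f x n = begin
  ((f ⊛ exp x) ⊛ expm1) n                  ≡⟨ ⊛-assoc f (exp x) expm1 n ⟩
  (f ⊛ (exp x ⊛ expm1)) n
    ≡⟨ ⊛-cong {f} (λ _ → refl) (λ k → trans (⊛-comm (exp x) expm1 k) (exp-diff x 1ℚ k)) n ⟩
  (f ⊛ (exp (x + 1ℚ) ⊝ exp x)) n           ≡⟨ ⊛-distribˡ-⊝ f (exp (x + 1ℚ)) (exp x) n ⟩
  (f ⊛ exp (x + 1ℚ)) n - (f ⊛ exp x) n     ∎
  where open ≡-Reasoning

scale-one : ∀ c → scale c one ≗ one
scale-one c zero    = refl
scale-one c (suc n) = *-zeroʳ (c ^ suc n)

scale-𝑡 : ∀ c → scale c 𝑡 ≗ c · 𝑡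
scale-𝑡 c zero          = sym (*-zeroʳ c)
scale-𝑡 c (suc zero)    = cong (_* 1ℚ) (*-identityʳ c)
scale-𝑡 c (suc (suc n)) = trans (*-zeroʳ (c ^ suc (suc n))) (sym (*-zeroʳ c))

scale-expm1 : ∀ c → scale c expm1 ≗ exp c ⊝ one
scale-expm1 c n = begin
  c ^ n * (exp 1ℚ n - one n)
    ≡⟨ solve 3 (λ a b d → a :* (b :- d) := a :* b :- a :* d) refl (c ^ n) (exp 1ℚ n) (one n) ⟩
  scale c (exp 1ℚ) n - scale c one n
    ≡⟨ cong₂ _-_ (trans (scale-exp c 1ℚ n) (cong (λ z → exp z n) (*-identityʳ c)))
         (scale-one c n) ⟩
  exp c n - one n                      ∎
  where open ≡-Reasoning

+-fromℕ-suc : ∀ x i → x + fromℕ (suc i) ≡ x + fromℕ i + 1ℚ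
+-fromℕ-suc x i = trans (cong (x +_) (trans (fromℕ-+ 1 i) (+-comm 1ℚ (fromℕ i))))
  (sym (+-assoc x (fromℕ i) 1ℚ))

-- After multiplication by eᵗ - 1 the left side telescopes to β(Nt)(e^{Nt} - 1)e^{xt}. Here
-- β(Nt)(e^{Nt} - 1) = Nt, which is `β-expm1` with Nt substituted for t, and the right side also
-- becomes Nt e^{xt}.
∑-scale-β-exp : ∀ N x →
  (λ n → ∑[ i < N ] (scale (fromℕ N) β ⊛ exp (x + fromℕ (toℕ i))) n)
    ≗ fromℕ N · bernoulliSeries x
∑-scale-β-exp N x = expm1-cancelʳ λ n → begin
  ((λ n → ∑[ i < N ] term (toℕ i) n) ⊛ expm1) n
    ≡⟨ ⊛-distribʳ-∑ {N} (λ i → term (toℕ i)) expm1 n ⟩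
  ∑[ i < N ] (term (toℕ i) ⊛ expm1) n
    ≡⟨ sum-cong-≗ {N} (λ i → trans (⊛-exp-⊛-expm1 βₙ (x + fromℕ (toℕ i)) n)
         (cong (λ z → (βₙ ⊛ exp z) n - term (toℕ i) n) (sym (+-fromℕ-suc x (toℕ i))))) ⟩
  ∑[ i < N ] (term (suc (toℕ i)) n - term (toℕ i) n)
    ≡⟨ ∑-telescope N (λ i → term i n) ⟩
  term N n - term 0 n
    ≡⟨ cong (λ z → term N n - (βₙ ⊛ exp z) n) (+-identityʳ x) ⟩
  term N n - (βₙ ⊛ exp x) n
    ≡⟨ ⊛-distribˡ-⊝ βₙ (exp (x + c)) (exp x) n ⟨
  (βₙ ⊛ (exp (x + c) ⊝ exp x)) n
    ≡⟨ ⊛-cong {βₙ} (λ _ → refl) (exp-diff x c) n ⟨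
  (βₙ ⊛ ((exp c ⊝ one) ⊛ exp x)) n
    ≡⟨ ⊛-assoc βₙ (exp c ⊝ one) (exp x) n ⟨
  ((βₙ ⊛ (exp c ⊝ one)) ⊛ exp x) n
    ≡⟨ ⊛-cong {g = exp x} scaled (λ _ → refl) n ⟩
  (c · 𝑡 ⊛ exp x) n
    ≡⟨ ·-⊛ c 𝑡 (exp x) n ⟩
  c * (𝑡 ⊛ exp x) n
    ≡⟨ cong (c *_) (bernoulli n) ⟨
  c * (bernoulliSeries x ⊛ expm1) n
    ≡⟨ ·-⊛ c (bernoulliSeries x) expm1 n ⟨
  (c · bernoulliSeries x ⊛ expm1) n ∎
  where
  open ≡-Reasoning
  c = fromℕ N
  βₙ = scale c β
  term : ℕ → Series
  term i = βₙ ⊛ exp (x + fromℕ i)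
  scaled : βₙ ⊛ (exp c ⊝ one) ≗ c · 𝑡
  scaled n = begin
    (βₙ ⊛ (exp c ⊝ one)) n   ≡⟨ ⊛-cong {βₙ} (λ _ → refl) (scale-expm1 c) n ⟨
    (βₙ ⊛ scale c expm1) n   ≡⟨ scale-⊛ c β expm1 n ⟩
    scale c (β ⊛ expm1) n    ≡⟨ cong (c ^ n *_) (β-expm1 n) ⟩
    scale c 𝑡 n              ≡⟨ scale-𝑡 c n ⟩
    c * 𝑡 n                  ∎
  bernoulli : bernoulliSeries x ⊛ expm1 ≗ 𝑡 ⊛ exp x
  bernoulli n = begin
    ((β ⊛ exp x) ⊛ expm1) n  ≡⟨ ⊛-assoc β (exp x) expm1 n ⟩
    (β ⊛ (exp x ⊛ expm1)) n  ≡⟨ ⊛-cong {β} (λ _ → refl) (⊛-comm (exp x) expm1) n ⟩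
    (β ⊛ (expm1 ⊛ exp x)) n  ≡⟨ ⊛-assoc β expm1 (exp x) n ⟨
    ((β ⊛ expm1) ⊛ exp x) n  ≡⟨ ⊛-cong {g = exp x} β-expm1 (λ _ → refl) n ⟩
    (𝑡 ⊛ exp x) n            ∎

-- The multiplication formula for Bernoulli polynomials.

fromℕ-*-/ℕ : ∀ h a m .{{_ : NonZero m}} → fromℕ h * (a /ℕ m) ≡ (h ℕ.* a) /ℕ m
fromℕ-*-/ℕ h a m = begin
  fromℕ h * (a /ℕ m)               ≡⟨ cong (fromℕ h *_) (/ℕ-def a m) ⟩
  fromℕ h * (fromℕ a * (1 /ℕ m))   ≡⟨ *-assoc (fromℕ h) (fromℕ a) (1 /ℕ m) ⟨
  fromℕ h * fromℕ a * (1 /ℕ m)     ≡⟨ cong (_* (1 /ℕ m)) (fromℕ-* h a) ⟨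
  fromℕ (h ℕ.* a) * (1 /ℕ m)       ≡⟨ /ℕ-def (h ℕ.* a) m ⟨
  (h ℕ.* a) /ℕ m                   ∎
  where open ≡-Reasoning

fromℕ-*-cancel : ∀ a m .{{_ : NonZero m}} → fromℕ m * (a /ℕ m) ≡ fromℕ a
fromℕ-*-cancel a m = begin
  fromℕ m * (a /ℕ m)               ≡⟨ cong (fromℕ m *_) (/ℕ-def a m) ⟩
  fromℕ m * (fromℕ a * (1 /ℕ m))
    ≡⟨ solve 3 (λ x y z → x :* (y :* z) := y :* (x :* z)) refl (fromℕ m) (fromℕ a) (1 /ℕ m) ⟩
  fromℕ a * (fromℕ m * (1 /ℕ m))   ≡⟨ cong (fromℕ a *_) (fromℕ-inverse m) ⟩
  fromℕ a * 1ℚ                     ≡⟨ *-identityʳ (fromℕ a) ⟩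
  fromℕ a                          ∎
  where open ≡-Reasoning

-- Compare coefficients of tⁿ in `∑-scale-β-exp` at hx. The factor hⁿ amounts to substituting ht for
-- t, which turns e^{(x + ν/h)t} into e^{(hx + ν)t}.
B-multiplication : ∀ n h .{{_ : NonZero h}} x →
  fromℕ h ^ n * ∑[ ν < h ] B n (x + toℕ ν /ℕ h) ≡ fromℕ h * B n (fromℕ h * x)
B-multiplication n h x = begin
  c ^ n * ∑[ ν < h ] (f * bernoulliSeries (x + toℕ ν /ℕ h) n)
    ≡⟨ cong (c ^ n *_) (*-distribˡ-sum {h} f (λ ν → bernoulliSeries (x + toℕ ν /ℕ h) n)) ⟨
  c ^ n * (f * ∑[ ν < h ] (bernoulliSeries (x + toℕ ν /ℕ h) n))
    ≡⟨ solve 3 (λ a b d → a :* (b :* d) := b :* (a :* d))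
         refl (c ^ n) f (∑[ ν < h ] (bernoulliSeries (x + toℕ ν /ℕ h) n)) ⟩
  f * (c ^ n * ∑[ ν < h ] (bernoulliSeries (x + toℕ ν /ℕ h) n))
    ≡⟨ cong (f *_) (*-distribˡ-sum {h} (c ^ n) (λ ν → bernoulliSeries (x + toℕ ν /ℕ h) n)) ⟩
  f * ∑[ ν < h ] (c ^ n * bernoulliSeries (x + toℕ ν /ℕ h) n)
    ≡⟨ cong (f *_) (sum-cong-≗ {h} term) ⟩
  f * ∑[ ν < h ] (scale c β ⊛ exp (c * x + fromℕ (toℕ ν))) n
    ≡⟨ cong (f *_) (∑-scale-β-exp h (c * x) n) ⟩
  f * (c * bernoulliSeries (c * x) n)
    ≡⟨ solve 3 (λ a b d → a :* (b :* d) := b :* (a :* d)) refl f c (bernoulliSeries (c * x) n) ⟩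
  c * (f * bernoulliSeries (c * x) n) ∎
  where
  open ≡-Reasoning
  c = fromℕ h
  f = fromℕ (n !)
  term : ∀ (ν : Fin h) → c ^ n * bernoulliSeries (x + toℕ ν /ℕ h) n
    ≡ (scale c β ⊛ exp (c * x + fromℕ (toℕ ν))) n
  term ν = begin
    scale c (β ⊛ exp y) n                          ≡⟨ scale-⊛ c β (exp y) n ⟨
    (scale c β ⊛ scale c (exp y)) n
      ≡⟨ ⊛-cong {scale c β} (λ _ → refl) (scale-exp c y) n ⟩
    (scale c β ⊛ exp (c * y)) n
      ≡⟨ cong (λ z → (scale c β ⊛ exp z) n) (trans (*-distribˡ-+ c x (toℕ ν /ℕ h))
           (cong (c * x +_) (fromℕ-*-cancel (toℕ ν) h))) ⟩
    (scale c β ⊛ exp (c * x + fromℕ (toℕ ν))) n    ∎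
    where y = x + toℕ ν /ℕ h

-- Floor and fractional part.

/1-mkℚ : ∀ i → i / 1 ≡ mkℚ i 0 (Coprimality.sym (Coprimality.1-coprimeTo ℤ.∣ i ∣))
/1-mkℚ i = ↥p/↧p≡p (mkℚ i 0 _)

/1-mono-≤ : ∀ {i j} → i ℤ.≤ j → i / 1 ≤ j / 1
-- `i / 1` is normalised by a gcd and does not reduce for a variable `i`, hence the passage to the
-- explicit form `mkℚ i 0`.
/1-mono-≤ {i} {j} i≤j = subst₂ _≤_ (sym (/1-mkℚ i)) (sym (/1-mkℚ j))
  (*≤* (ℤ.*-monoʳ-≤-nonNeg (ℤ.+ 1) i≤j))

/1-cancel-< : ∀ {i j} → i / 1 < j / 1 → i ℤ.< j
/1-cancel-< {i} {j} i<j = ℤ.*-cancelʳ-<-nonNeg (ℤ.+ 1)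
  (drop-*<* (subst₂ _<_ (/1-mkℚ i) (/1-mkℚ j) i<j))

floor≤ : ∀ x → floor x / 1 ≤ x
-- Matching on the record lets `floor x` reduce to the integer quotient of numerator by denominator.
floor≤ x@record{} = subst (_≤ x) (sym (/1-mkℚ (floor x)))
  (*≤* (subst (floor x ℤ.* ↧ x ℤ.≤_) (sym (ℤ.*-identityʳ (↥ x))) (ℤ.[n/d]*d≤n (↥ x) (↧ x))))

<suc-floor : ∀ x → x < ℤ.suc (floor x) / 1
<suc-floor x@record{} = subst (x <_) (sym (/1-mkℚ (ℤ.suc (floor x))))
  (*<* (subst₂ ℤ._<_ (sym (ℤ.*-identityʳ (↥ x)))
    (cong (λ q → ℤ.suc q ℤ.* ↧ x) (sym (ℤ.div-pos-is-/ℕ (↥ x) (↧ₙ x))))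
    (ℤ.n<s[n/ℕd]*d (↥ x) (↧ₙ x))))

/1-suc : ∀ i → ℤ.suc i / 1 ≡ i / 1 + 1ℚ
/1-suc i = trans (fromℤ-+ (ℤ.+ 1) i) (+-comm 1ℚ (i / 1))

i<suc[j]⇒i≤j : ∀ {i j} → i ℤ.< ℤ.suc j → i ℤ.≤ j
i<suc[j]⇒i≤j {i} {j} i<1+j = subst (i ℤ.≤_) (ℤ.pred-suc j) (ℤ.i<j⇒i≤pred[j] i<1+j)

-- Both `floor x` and `i` are at most x, and x is below the successor of each. So each integer is
-- less than the successor of the other.
floor-unique : ∀ {x i} → i / 1 ≤ x → x < ℤ.suc i / 1 → floor x ≡ i
floor-unique {x} {i} i≤x x<1+i = ℤ.≤-antisym
  (i<suc[j]⇒i≤j (/1-cancel-< (≤-<-trans (floor≤ x) x<1+i)))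
  (i<suc[j]⇒i≤j (/1-cancel-< (≤-<-trans i≤x (<suc-floor x))))

x≡⟨x⟩+floor : ∀ x → x ≡ ⟨ x ⟩ + floor x / 1
x≡⟨x⟩+floor x = solve 2 (λ x k → x := (x :- k) :+ k) refl x (floor x / 1)

0≤⟨x⟩ : ∀ x → 0ℚ ≤ ⟨ x ⟩
0≤⟨x⟩ x = subst (_≤ ⟨ x ⟩) (+-inverseʳ (floor x / 1)) (+-monoˡ-≤ (- (floor x / 1)) (floor≤ x))

⟨x⟩<1 : ∀ x → ⟨ x ⟩ < 1ℚ
⟨x⟩<1 x = subst (⟨ x ⟩ <_)
  (trans (cong (_- k) (/1-suc (floor x)))
    (solve 1 (λ k → (k :+ con 1ℚ) :- k := con 1ℚ) refl k))
  (+-monoˡ-< (- k) (<suc-floor x))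
  where k = floor x / 1

-- The floor of `y + i / 1` is `i` by `floor-unique`. Both the fixed points of `⟨_⟩` and its
-- periodicity follow from this.
⟨⟩-unique : ∀ {y} i → 0ℚ ≤ y → y < 1ℚ → ⟨ y + i / 1 ⟩ ≡ y
⟨⟩-unique {y} i 0≤y y<1 = trans (cong (λ j → y + i / 1 - j / 1) floor≡i)
  (solve 2 (λ y k → (y :+ k) :- k := y) refl y (i / 1))
  where
  floor≡i : floor (y + i / 1) ≡ i
  floor≡i = floor-unique
    (subst (_≤ y + i / 1) (+-identityˡ (i / 1)) (+-monoˡ-≤ (i / 1) 0≤y))
    (subst (y + i / 1 <_) (trans (+-comm 1ℚ (i / 1)) (sym (/1-suc i))) (+-monoˡ-< (i / 1) y<1))

⟨⟩-fixed : ∀ {y} → 0ℚ ≤ y → y < 1ℚ → ⟨ y ⟩ ≡ y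
⟨⟩-fixed {y} 0≤y y<1 = trans (cong ⟨_⟩ (sym (+-identityʳ y))) (⟨⟩-unique (ℤ.+ 0) 0≤y y<1)

⟨⟩-periodic : ∀ x i → ⟨ x + i / 1 ⟩ ≡ ⟨ x ⟩
⟨⟩-periodic x i = begin
  ⟨ x + i / 1 ⟩                         ≡⟨ cong (λ z → ⟨ z + i / 1 ⟩) (x≡⟨x⟩+floor x) ⟩
  ⟨ ⟨ x ⟩ + floor x / 1 + i / 1 ⟩       ≡⟨ cong ⟨_⟩ (+-assoc ⟨ x ⟩ (floor x / 1) (i / 1)) ⟩
  ⟨ ⟨ x ⟩ + (floor x / 1 + i / 1) ⟩     ≡⟨ cong (λ z → ⟨ ⟨ x ⟩ + z ⟩) (fromℤ-+ (floor x) i) ⟨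
  ⟨ ⟨ x ⟩ + (floor x ℤ.+ i) / 1 ⟩       ≡⟨ ⟨⟩-unique (floor x ℤ.+ i) (0≤⟨x⟩ x) (⟨x⟩<1 x) ⟩
  ⟨ x ⟩                                 ∎
  where open ≡-Reasoning

-- Periodicity, and the multiplication formula for `B̄`.

B̄-periodic : ∀ n x i → B̄ n (x + i / 1) ≡ B̄ n x
B̄-periodic n x i = cong (B n) (⟨⟩-periodic x i)

module _ {A : Set} {f : ℚ → A} (δ : ℚ) (period : ∀ x → f (x + δ) ≡ f x) where

  ℕ-multiple-period : ∀ k x → f (x + fromℕ k * δ) ≡ f x
  ℕ-multiple-period zero    x = cong f (trans (cong (x +_) (*-zeroˡ δ)) (+-identityʳ x))
  ℕ-multiple-period (suc k) x = begin
    f (x + fromℕ (suc k) * δ)       ≡⟨ cong (λ z → f (x + z * δ)) (fromℕ-+ 1 k) ⟩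
    f (x + (1ℚ + fromℕ k) * δ)
      ≡⟨ cong f (solve 3 (λ x k δ → x :+ (con 1ℚ :+ k) :* δ := (x :+ k :* δ) :+ δ)
           refl x (fromℕ k) δ) ⟩
    f (x + fromℕ k * δ + δ)         ≡⟨ period (x + fromℕ k * δ) ⟩
    f (x + fromℕ k * δ)             ≡⟨ ℕ-multiple-period k x ⟩
    f x                             ∎
    where open ≡-Reasoning

  multiple-period : ∀ i x → f (x + i / 1 * δ) ≡ f x
  multiple-period (ℤ.+ k)    x = ℕ-multiple-period k x
  multiple-period (ℤ.-[1+ k ]) x = trans
    -- For a negative multiple, the positive case is applied at the translated point and leads back
    -- to `x`.
    (sym (ℕ-multiple-period (suc k) (x + - c * δ)))
    (cong f (solve 3 (λ x c δ → (x :+ (:- c) :* δ) :+ c :* δ := x) refl x c δ ))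
    where c = fromℕ (suc k)

-- The shift replaces ν by ν + 1. The term gained, at x + h/h = x + 1, equals the term lost, at x,
-- because `B̄ n` has period 1.
∑-B̄-shift : ∀ n h .{{_ : NonZero h}} x →
  ∑[ ν < h ] B̄ n (x + 1 /ℕ h + toℕ ν /ℕ h) ≡ ∑[ ν < h ] B̄ n (x + toℕ ν /ℕ h)
∑-B̄-shift n h x = begin
  ∑[ ν < h ] B̄ n (x + 1 /ℕ h + toℕ ν /ℕ h)
    ≡⟨ sum-cong-≗ {h} (λ ν → cong (B̄ n) (step (toℕ ν))) ⟩
  ∑[ ν < h ] g (suc (toℕ ν))
    -- Writing g(ν + 1) as g(ν) plus a difference isolates a telescoping sum, whose value g(h) -
    -- g(0) is 0.
    ≡⟨ sum-cong-≗ {h} (λ ν → solve 2 (λ a b → b := a :+ (b :- a))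
         refl (g (toℕ ν)) (g (suc (toℕ ν)))) ⟩
  ∑[ ν < h ] (g (toℕ ν) + (g (suc (toℕ ν)) - g (toℕ ν)))
    ≡⟨ ∑-distrib-+ {h} (λ ν → g (toℕ ν)) (λ ν → g (suc (toℕ ν)) - g (toℕ ν)) ⟩
  ∑[ ν < h ] g (toℕ ν) + ∑[ ν < h ] (g (suc (toℕ ν)) - g (toℕ ν))
    ≡⟨ cong (∑[ ν < h ] g (toℕ ν) +_) (trans (∑-telescope h g)
         (trans (cong (_- g 0) wrap) (+-inverseʳ (g 0)))) ⟩
  ∑[ ν < h ] g (toℕ ν) + 0ℚ
    ≡⟨ +-identityʳ (∑[ ν < h ] g (toℕ ν)) ⟩
  ∑[ ν < h ] g (toℕ ν) ∎
  where
  open ≡-Reasoning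
  g : ℕ → ℚ
  g i = B̄ n (x + i /ℕ h)
  step : ∀ i → x + 1 /ℕ h + i /ℕ h ≡ x + suc i /ℕ h
  step i = trans (+-assoc x (1 /ℕ h) (i /ℕ h)) (cong (x +_) (begin
    1 /ℕ h + i /ℕ h                    ≡⟨ cong (1 /ℕ h +_) (/ℕ-def i h) ⟩
    1 /ℕ h + fromℕ i * (1 /ℕ h)
      ≡⟨ solve 2 (λ a k → a :+ k :* a := (con 1ℚ :+ k) :* a) refl (1 /ℕ h) (fromℕ i) ⟩
    (1ℚ + fromℕ i) * (1 /ℕ h)          ≡⟨ cong (_* (1 /ℕ h)) (fromℕ-+ 1 i) ⟨
    fromℕ (suc i) * (1 /ℕ h)           ≡⟨ /ℕ-def (suc i) h ⟨
    suc i /ℕ h                         ∎))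
  wrap : g h ≡ g 0
  wrap = begin
    B̄ n (x + h /ℕ h)
      ≡⟨ cong (λ z → B̄ n (x + z)) (trans (/ℕ-def h h) (fromℕ-inverse h)) ⟩
    B̄ n (x + ℤ.+ 1 / 1)        ≡⟨ B̄-periodic n x (ℤ.+ 1) ⟩
    B̄ n x                      ≡⟨ cong (B̄ n) (+-identityʳ x) ⟨
    B̄ n (x + 0ℚ)
      ≡⟨ cong (λ z → B̄ n (x + z)) (trans (/ℕ-def 0 h) (*-zeroˡ (1 /ℕ h))) ⟨
    B̄ n (x + 0 /ℕ h)           ∎

-- Write hx = z + k with k an integer and 0 ≤ z < 1, so that x = y + k/h with y = z/h. The sum does
-- not change under the shift by k/h, and every y + ν/h with ν < h lies in [0, 1), where `B̄ n`
-- agrees with `B n`.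
B̄-multiplication : ∀ n h .{{_ : NonZero h}} x →
  fromℕ h ^ n * ∑[ ν < h ] B̄ n (x + toℕ ν /ℕ h) ≡ fromℕ h * B̄ n (fromℕ h * x)
B̄-multiplication n h@(suc _) x = begin
  c ^ n * F x
    ≡⟨ cong (λ z → c ^ n * F z) x≡ ⟩
  c ^ n * F (y + k / 1 * (1 /ℕ h))
    ≡⟨ cong (c ^ n *_) (multiple-period (1 /ℕ h) (∑-B̄-shift n h) k y) ⟩
  c ^ n * F y
    ≡⟨ cong (c ^ n *_) (sum-cong-≗ {h} (λ ν → cong (B n)
         (⟨⟩-fixed (nonneg (toℕ ν)) (below-1 ν)))) ⟩
  c ^ n * ∑[ ν < h ] B n (y + toℕ ν /ℕ h)
    ≡⟨ B-multiplication n h y ⟩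
  c * B n (c * y)
    -- Since `z` is `⟨ c * x ⟩`, the value `B n z` is already `B̄ n (c * x)`.
    ≡⟨ cong (λ z → c * B n z) (unscale z) ⟩
  c * B̄ n (c * x) ∎
  where
  open ≡-Reasoning
  c = fromℕ h
  F : ℚ → ℚ
  F x = ∑[ ν < h ] B̄ n (x + toℕ ν /ℕ h)
  z = ⟨ c * x ⟩
  k = floor (c * x)
  y = z * (1 /ℕ h)
  unscale : ∀ u → c * (u * (1 /ℕ h)) ≡ u
  unscale u = trans (solve 3 (λ c u r → c :* (u :* r) := u :* (c :* r)) refl c u (1 /ℕ h))
    (trans (cong (u *_) (fromℕ-inverse h)) (*-identityʳ u))
  x≡ : x ≡ y + k / 1 * (1 /ℕ h)
  x≡ = begin
    x                            ≡⟨ unscale x ⟨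
    c * (x * (1 /ℕ h))           ≡⟨ *-assoc c x (1 /ℕ h) ⟨
    c * x * (1 /ℕ h)             ≡⟨ cong (_* (1 /ℕ h)) (x≡⟨x⟩+floor (c * x)) ⟩
    (z + k / 1) * (1 /ℕ h)       ≡⟨ *-distribʳ-+ (1 /ℕ h) z (k / 1) ⟩
    y + k / 1 * (1 /ℕ h)         ∎
  combine : ∀ i → y + i /ℕ h ≡ (z + fromℕ i) * (1 /ℕ h)
  combine i = trans (cong (y +_) (/ℕ-def i h)) (sym (*-distribʳ-+ (1 /ℕ h) z (fromℕ i)))
  instance
    1/h-pos : Positive (1 /ℕ h)
    1/h-pos = normalize-pos 1 h
    1/h-nonNeg : NonNegative (1 /ℕ h)
    1/h-nonNeg = pos⇒nonNeg (1 /ℕ h)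
  nonneg : ∀ i → 0ℚ ≤ y + i /ℕ h
  nonneg i = subst₂ _≤_ (*-zeroˡ (1 /ℕ h)) (sym (combine i))
    (*-monoʳ-≤-nonNeg (1 /ℕ h) (subst (_≤ z + fromℕ i) (+-identityʳ 0ℚ)
      (+-mono-≤ (0≤⟨x⟩ (c * x)) (/1-mono-≤ {ℤ.+ 0} {ℤ.+ i} (ℤ.+≤+ ℕ.z≤n)))))
  below-1 : ∀ (ν : Fin h) → y + toℕ ν /ℕ h < 1ℚ
  below-1 ν = subst₂ _<_ (sym (combine (toℕ ν))) (fromℕ-inverse h)
    -- From z < 1 and 1 + ν ≤ h follows z + ν < h, which is then divided by h.
    (*-monoˡ-<-pos (1 /ℕ h) (<-≤-trans (+-monoˡ-< (fromℕ (toℕ ν)) (⟨x⟩<1 (c * x)))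
      (subst (_≤ c) (fromℕ-+ 1 (toℕ ν)) (/1-mono-≤ (ℤ.+≤+ (toℕ<n ν))))))

-- Dedekind sums as double sums, and reciprocity.

-- For fixed μ the weight does not depend on ν, so `B̄-multiplication` collapses the inner sum to a
-- multiple of B̄ₚ(hμ/m). The half of the double sum with weight mν is covered by exchanging m and
-- h.
dedekind-double-sum : ∀ m h p .{{_ : NonZero m}} .{{_ : NonZero h}} .{{_ : NonZero p}} →
  fromℕ h * fromℕ m ^ p * S p h m
    ≡ ∑[ μ < m ] (∑[ ν < h ]
        (fromℕ (m ℕ.* h) ^ (p ∸ 1) * fromℕ (toℕ μ ℕ.* h) * B̄ p (toℕ ν /ℕ h + toℕ μ /ℕ m)))
dedekind-double-sum m@(suc m-1) h p@(suc q) = sym (begin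
  ∑[ μ < m ] (∑[ ν < h ]
    (fromℕ (m ℕ.* h) ^ q * fromℕ (toℕ μ ℕ.* h) * B̄ p (toℕ ν /ℕ h + toℕ μ /ℕ m)))
    ≡⟨ sum-cong-≗ {m} (λ μ → inner (toℕ μ)) ⟩
  y * x ^ q * 0ℚ * b 0 + rest
    -- The term μ = 0, which `S` omits, has weight 0.
    ≡⟨ cong (_+ rest) (solve 2 (λ a b → a :* con 0ℚ :* b := con 0ℚ) refl (y * x ^ q) (b 0)) ⟩
  0ℚ + rest
    ≡⟨ +-identityˡ rest ⟩
  rest
    ≡⟨ sum-cong-≗ {m-1} (λ i → absorb (suc (toℕ i))) ⟩
  ∑[ i < m-1 ] (y * x ^ p * (suc (toℕ i) /ℕ m * b (suc (toℕ i))))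
    ≡⟨ *-distribˡ-sum {m-1} (y * x ^ p) (λ i → suc (toℕ i) /ℕ m * b (suc (toℕ i))) ⟨
  y * x ^ p * S p h m ∎)
  where
  open ≡-Reasoning
  x = fromℕ m
  y = fromℕ h
  b : ℕ → ℚ
  b μ = B̄ p ((h ℕ.* μ) /ℕ m)
  rest = ∑[ i < m-1 ] (y * x ^ q * fromℕ (suc (toℕ i)) * b (suc (toℕ i)))
  absorb : ∀ μ → y * x ^ q * fromℕ μ * b μ ≡ y * x ^ p * (μ /ℕ m * b μ)
  absorb μ = begin
    -- Writing μ as m · (μ/m) supplies the factor that raises m^{p-1} to mᵖ.
    y * x ^ q * fromℕ μ * b μ        ≡⟨ cong (λ u → y * x ^ q * u * b μ) (fromℕ-*-cancel μ m) ⟨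
    y * x ^ q * (x * (μ /ℕ m)) * b μ
      ≡⟨ solve 5 (λ y z x u b → y :* z :* (x :* u) :* b := y :* (x :* z) :* (u :* b))
           refl y (x ^ q) x (μ /ℕ m) (b μ) ⟩
    y * x ^ p * (μ /ℕ m * b μ)       ∎
  inner : ∀ μ →
    ∑[ ν < h ] (fromℕ (m ℕ.* h) ^ q * fromℕ (μ ℕ.* h) * B̄ p (toℕ ν /ℕ h + μ /ℕ m))
      ≡ y * x ^ q * fromℕ μ * b μ
  inner μ = begin
    ∑[ ν < h ] (fromℕ (m ℕ.* h) ^ q * fromℕ (μ ℕ.* h) * B̄ p (toℕ ν /ℕ h + μ /ℕ m))
      ≡⟨ *-distribˡ-sum {h} (fromℕ (m ℕ.* h) ^ q * fromℕ (μ ℕ.* h))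
           (λ ν → B̄ p (toℕ ν /ℕ h + μ /ℕ m)) ⟨
    fromℕ (m ℕ.* h) ^ q * fromℕ (μ ℕ.* h) * ∑[ ν < h ] B̄ p (toℕ ν /ℕ h + μ /ℕ m)
      ≡⟨ cong₂ _*_
           (cong₂ _*_ (trans (cong (_^ q) (fromℕ-* m h)) (^-distrib-* x y q)) (fromℕ-* μ h))
           (sum-cong-≗ {h} (λ ν → cong (B̄ p) (+-comm (toℕ ν /ℕ h) (μ /ℕ m)))) ⟩
    x ^ q * y ^ q * (fromℕ μ * y) * s
      -- The factor h of the weight μh raises h^{p-1} to the hᵖ that `B̄-multiplication` requires.
      ≡⟨ solve 5 (λ a c μ y s → a :* c :* (μ :* y) :* s := a :* μ :* (y :* c :* s))
           refl (x ^ q) (y ^ q) (fromℕ μ) y s ⟩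
    x ^ q * fromℕ μ * (y ^ p * s)
      ≡⟨ cong (x ^ q * fromℕ μ *_) (B̄-multiplication p h (μ /ℕ m)) ⟩
    x ^ q * fromℕ μ * (y * B̄ p (y * (μ /ℕ m)))
      ≡⟨ cong (λ u → x ^ q * fromℕ μ * (y * B̄ p u)) (fromℕ-*-/ℕ h μ m) ⟩
    x ^ q * fromℕ μ * (y * b μ)
      ≡⟨ solve 4 (λ a μ y b → a :* μ :* (y :* b) := y :* a :* μ :* b)
           refl (x ^ q) (fromℕ μ) y (b μ) ⟩
    y * x ^ q * fromℕ μ * b μ ∎
    where s = ∑[ ν < h ] B̄ p (μ /ℕ m + toℕ ν /ℕ h)

corollary11 : ∀ (m h p : ℕ) .{{_ : NonZero m}} .{{_ : NonZero h}} .{{_ : NonZero p}} →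
    (fromℕ h * fromℕ m ^ p * S p h m + fromℕ m * fromℕ h ^ p * S p m h
    ≡ ∑[ μ < m ] (∑[ ν < h ]
    (fromℕ (m ℕ.* h) ^ (p ∸ 1)
    * fromℕ (toℕ μ ℕ.* h ℕ.+ m ℕ.* toℕ ν)
    * B̄ p (toℕ ν /ℕ h + toℕ μ /ℕ m))))
    ×
    (∑[ μ < m ] (∑[ ν < h ]
    (fromℕ (m ℕ.* h) ^ (p ∸ 1)
    * fromℕ (toℕ μ ℕ.* h ℕ.+ m ℕ.* toℕ ν)
    * B̄ p (toℕ ν /ℕ h + toℕ μ /ℕ m)))
    ≡ fromℕ (m ℕ.* h) ^ p
    * ∑[ μ < m ] (∑[ ν < h ]
    ((1 /ℕ (m ℕ.* h)) {{m*n≢0 m h}}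
    * fromℕ (toℕ μ ℕ.* h ℕ.+ m ℕ.* toℕ ν)
    * B̄ p (toℕ ν /ℕ h + toℕ μ /ℕ m))))
corollary11 m h p@(suc q) = reciprocity , sym rescale
  where
  open ≡-Reasoning
  r = (1 /ℕ (m ℕ.* h)) {{m*n≢0 m h}}
  c = fromℕ (m ℕ.* h)
  w : ℕ → ℕ → ℚ
  w μ ν = fromℕ (μ ℕ.* h ℕ.+ m ℕ.* ν)
  b : ℕ → ℕ → ℚ
  b μ ν = B̄ p (ν /ℕ h + μ /ℕ m)
  u v : Fin m → Fin h → ℚ
  u μ ν = c ^ q * fromℕ (toℕ μ ℕ.* h) * b (toℕ μ) (toℕ ν)
  v μ ν = c ^ q * fromℕ (m ℕ.* toℕ ν) * b (toℕ μ) (toℕ ν)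

  flip-v : ∀ (ν : Fin h) (μ : Fin m) →
    fromℕ (h ℕ.* m) ^ q * fromℕ (toℕ ν ℕ.* m) * B̄ p (toℕ μ /ℕ m + toℕ ν /ℕ h) ≡ v μ ν
  flip-v ν μ = cong₂ _*_
    (cong₂ (λ i j → fromℕ i ^ q * fromℕ j) (ℕ.*-comm h m) (ℕ.*-comm (toℕ ν) m))
    (cong (B̄ p) (+-comm (toℕ μ /ℕ m) (toℕ ν /ℕ h)))

  reciprocity : fromℕ h * fromℕ m ^ p * S p h m + fromℕ m * fromℕ h ^ p * S p m h
    ≡ ∑[ μ < m ] (∑[ ν < h ] (c ^ q * w (toℕ μ) (toℕ ν) * b (toℕ μ) (toℕ ν)))
  reciprocity = begin
    fromℕ h * fromℕ m ^ p * S p h m + fromℕ m * fromℕ h ^ p * S p m h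
      -- The second Dedekind sum arrives with m and h exchanged, so its order of summation is
      -- reversed before the two are added.
      ≡⟨ cong₂ _+_ (dedekind-double-sum m h p) (trans (dedekind-double-sum h m p)
           (trans (sum-cong-≗ {h} (λ ν → sum-cong-≗ {m} (flip-v ν)))
             (∑-comm {h} {m} (λ ν μ → v μ ν)))) ⟩
    ∑[ μ < m ] (∑[ ν < h ] u μ ν) + ∑[ μ < m ] (∑[ ν < h ] v μ ν)
      ≡⟨ ∑-distrib-+ {m} (λ μ → ∑[ ν < h ] u μ ν) (λ μ → ∑[ ν < h ] v μ ν) ⟨
    ∑[ μ < m ] (∑[ ν < h ] u μ ν + ∑[ ν < h ] v μ ν)
      ≡⟨ sum-cong-≗ {m} (λ μ → ∑-distrib-+ {h} (u μ) (v μ)) ⟨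
    ∑[ μ < m ] (∑[ ν < h ] (u μ ν + v μ ν))
      ≡⟨ sum-cong-≗ {m} (λ μ → sum-cong-≗ {h} (λ ν → merge (toℕ μ) (toℕ ν))) ⟩
    ∑[ μ < m ] (∑[ ν < h ] (c ^ q * w (toℕ μ) (toℕ ν) * b (toℕ μ) (toℕ ν))) ∎
    where
    merge : ∀ μ ν → c ^ q * fromℕ (μ ℕ.* h) * b μ ν + c ^ q * fromℕ (m ℕ.* ν) * b μ ν
      ≡ c ^ q * w μ ν * b μ ν
    merge μ ν = trans
      (solve 4 (λ a s t b → a :* s :* b :+ a :* t :* b := a :* (s :+ t) :* b)
        refl (c ^ q) (fromℕ (μ ℕ.* h)) (fromℕ (m ℕ.* ν)) (b μ ν))
      (cong (λ z → c ^ q * z * b μ ν) (sym (fromℕ-+ (μ ℕ.* h) (m ℕ.* ν))))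

  rescale : c ^ p * ∑[ μ < m ] (∑[ ν < h ] (r * w (toℕ μ) (toℕ ν) * b (toℕ μ) (toℕ ν)))
    ≡ ∑[ μ < m ] (∑[ ν < h ] (c ^ q * w (toℕ μ) (toℕ ν) * b (toℕ μ) (toℕ ν)))
  rescale = trans
    (*-distribˡ-sum {m} (c ^ p) (λ μ → ∑[ ν < h ] (r * w (toℕ μ) (toℕ ν) * b (toℕ μ) (toℕ ν))))
    (sum-cong-≗ {m} λ μ → trans
      (*-distribˡ-sum {h} (c ^ p) (λ ν → r * w (toℕ μ) (toℕ ν) * b (toℕ μ) (toℕ ν)))
      (sum-cong-≗ {h} λ ν → term (w (toℕ μ) (toℕ ν)) (b (toℕ μ) (toℕ ν))))
    where
    -- As p = q + 1, one factor mh of (mh)ᵖ splits off and cancels (mh)⁻¹.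
    term : ∀ w b → c ^ p * (r * w * b) ≡ c ^ q * w * b
    term w b = begin
      c * c ^ q * (r * w * b)
        ≡⟨ solve 5 (λ c a r w b → c :* a :* (r :* w :* b) := (c :* r) :* (a :* w :* b))
             refl c (c ^ q) r w b ⟩
      c * r * (c ^ q * w * b)
        ≡⟨ cong (_* (c ^ q * w * b)) (fromℕ-inverse (m ℕ.* h) {{m*n≢0 m h}}) ⟩
      1ℚ * (c ^ q * w * b)
        ≡⟨ *-identityˡ (c ^ q * w * b) ⟩
      c ^ q * w * b ∎
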